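{- Let $G$ be a loopless multigraph with $n$ vertices, $m$ edges and maximum degree $\Delta$, and let $q\in\mathbb{N}$ and $\lambda\ge1$. Then $$Z(G,\lambda,q)\le\left(1+q^{ -1}(\lambda^\Delta-1)\right)^{\lceil m/\Delta\rceil}q^n.$$ Moreover, if $\Delta$ divides $m$ and $2m/\Delta\le n$, equality holds for $G=H(n,m,\Delta)$.
   Context: For a loopless multigraph $G=(V,E)$ (multiple edges allowed), $Z(G,\lambda,q)=\sum_{\sigma\in[q]^V}\lambda^{\mu(\sigma)}$, where $\mu(\sigma)$ is the number of edges (counted with multiplicity) whose two endpoints receive the same colour under $\sigma$. For positive integers $n,m,\Delta$ with $\Delta\mid m$ and $m\le\Delta n/2$, $H(n,m,\Delta)$ is the multigraph on $n$ vertices obtained by taking $m/\Delta$ pairwise disjoint (independent) edges and replacing each by $\Delta$ parallel edges. -}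

module Defs where

open import Algebra.Apartness.Bundles using (HeytingCommutativeRing)
open import Algebra.Apartness.Structures using (IsHeytingField)
import Algebra.Apartness.Properties.HeytingCommutativeRing as HeytingProperties
open import Algebra.Bundles using (CommutativeRing)
open import Algebra.Core using (Op₁; Op₂)
import Algebra.Properties.CommutativeMonoid.Sum as Sum
import Algebra.Properties.Ring as RingProperties
import Algebra.Properties.Semiring.Exp as Exp
import Algebra.Properties.Semiring.Mult as Mult
open import Data.Fin.Base using (Fin; combine; inject≤)
open import Data.Fin.Patterns using (0F; 1F)
open import Data.Fin.Properties using (_≟_; combine-injective; inject≤-injective)
open import Data.List.Base using (List; []; _∷_; length; filter; concatMap; replicate; allFin)
open import Data.List.Properties using (length-++; length-replicate; length-tabulate; filter-++; filter-all; filter-none)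
open import Data.List.Relation.Unary.All as All using (All; []; _∷_)
import Data.List.Relation.Unary.All.Properties as All
open import Data.List.Relation.Unary.AllPairs using ([]; _∷_)
open import Data.List.Relation.Unary.Unique.Propositional using (Unique)
open import Data.List.Relation.Unary.Unique.Propositional.Properties using (allFin⁺)
open import Data.Nat.Base as ℕ using (ℕ; zero; suc; NonZero)
open import Data.Nat.Divisibility using (_∣_; quotient; divides)
open import Data.Nat.DivMod using (_/_; m*n/n≡m)
import Data.Nat.Properties as ℕ
open import Data.Product.Base using (_×_; _,_; ∃; proj₁; proj₂; uncurry)
open import Data.Sum.Base using (_⊎_; inj₁; inj₂; [_,_]′)
import Data.Vec.Functional as Vector
open import Level as Level using (_⊔_)
open import Relation.Binary.Core using (Rel)
open import Relation.Binary.PropositionalEquality as ≡ using (_≡_; _≢_; cong; cong₂; subst)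
open import Relation.Binary.Structures using (IsStrictPartialOrder)
open import Relation.Nullary using (¬_; Dec; yes; no; _⊎-dec_; contradiction)

------------------------------------------------------------------------
-- Ordered fields

-- The real numbers form an ordered field in this sense, also
-- constructively: two elements are apart when one is below the other, and
-- elements apart from 0# are invertible.  The order is not assumed to be
-- decidable.  Read classically, `tight` and `_#_` make `_<_` a total
-- strict order, and this is the usual notion of ordered field.

record OrderedField c ℓ₁ ℓ₂ : Set (Level.suc (c ⊔ ℓ₁ ⊔ ℓ₂)) where
  infix  8 -_
  infixl 7 _*_
  infixl 6 _+_
  infix  4 _≈_ _<_ _≤_ _#_
  field
    Carrier : Set c
    _≈_     : Rel Carrier ℓ₁
    _<_     : Rel Carrier ℓ₂
    _+_     : Op₂ Carrier
    _*_     : Op₂ Carrier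
    -_      : Op₁ Carrier
    0#      : Carrier
    1#      : Carrier

  _#_ : Rel Carrier ℓ₂
  x # y = x < y ⊎ y < x

  _≤_ : Rel Carrier ℓ₂
  x ≤ y = ¬ (y < x)

  field
    isHeytingField       : IsHeytingField _≈_ _#_ _+_ _*_ -_ 0# 1#
    isStrictPartialOrder : IsStrictPartialOrder _≈_ _<_
    +-monoˡ-<            : ∀ {x y} z → x < y → x + z < y + z
    *-pos                : ∀ {x y} → 0# < x → 0# < y → 0# < x * y

  open IsHeytingField isHeytingField public
  open IsStrictPartialOrder isStrictPartialOrder public
    using (<-resp-≈; <-respˡ-≈; <-respʳ-≈)
    renaming (irrefl to <-irrefl; trans to <-trans; asym to <-asym)

  heytingCommutativeRing : HeytingCommutativeRing c ℓ₁ ℓ₂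
  heytingCommutativeRing = record { isHeytingCommutativeRing = isHeytingCommutativeRing }

  commutativeRing : CommutativeRing c ℓ₁
  commutativeRing = HeytingCommutativeRing.commutativeRing heytingCommutativeRing

  open CommutativeRing commutativeRing public
    using (ring; semiring; +-commutativeMonoid)

  open Exp semiring public using (_^_)
  open Mult semiring public using () renaming (_×_ to _·_)

  fromℕ : ℕ → Carrier
  fromℕ k = k · 1#

  open HeytingProperties heytingCommutativeRing public using (1#0; x-0≈x)

  0<1 : 0# < 1#
  0<1 = [ negative , (λ 0<1 → 0<1) ]′ 1#0
    where
    open RingProperties ring using (-1*x≈-x; -‿involutive)

    negative : 1# < 0# → 0# < 1#
    negative 1<0 =
      <-respʳ-≈ (trans (-1*x≈-x (- 1#)) (-‿involutive 1#)) (*-pos 0<-1 0<-1)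
      where
      0<-1 : 0# < - 1#
      0<-1 = <-respˡ-≈ (-‿inverseʳ 1#)
               (<-respʳ-≈ (+-identityˡ (- 1#)) (+-monoˡ-< (- 1#) 1<0))

  0<fromℕ : ∀ k .{{_ : NonZero k}} → 0# < fromℕ k
  0<fromℕ (suc zero)    = <-respʳ-≈ (sym (+-identityʳ 1#)) 0<1
  0<fromℕ (suc (suc k)) = <-trans (0<fromℕ (suc k))
    (<-respˡ-≈ (+-identityˡ _) (+-monoˡ-< (fromℕ (suc k)) 0<1))

  infix 8 _⁻¹
  _⁻¹ : ∀ k .{{_ : NonZero k}} → Carrier
  k ⁻¹ = proj₁ (#⇒invertible (inj₂ (0<fromℕ k)))

  ⁻¹-inverse : ∀ k .{{_ : NonZero k}} → k ⁻¹ * fromℕ k ≈ 1#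
  ⁻¹-inverse k = trans (*-congˡ (sym (x-0≈x (fromℕ k))))
    (proj₁ (proj₂ (#⇒invertible (inj₂ (0<fromℕ k)))))

------------------------------------------------------------------------
-- Multigraphs

-- Vertices are the elements of Fin n.  The order of the two endpoints in a
-- pair carries no meaning, and parallel edges are repeated list entries.

record Multigraph (n : ℕ) : Set where
  field
    edges    : List (Fin n × Fin n)
    loopless : All (uncurry _≢_) edges

open Multigraph public

numEdges : ∀ {n} → Multigraph n → ℕ
numEdges G = length (edges G)

Incident : ∀ {n} → Fin n → Fin n × Fin n → Set
Incident v (a , b) = v ≡ a ⊎ v ≡ b

incident? : ∀ {n} (v : Fin n) e → Dec (Incident v e)
incident? v (a , b) = v ≟ a ⊎-dec v ≟ b

degree : ∀ {n} → Multigraph n → Fin n → ℕ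
degree G v = length (filter (incident? v) (edges G))

HasMaxDegree : ∀ {n} → Multigraph n → ℕ → Set
HasMaxDegree G Δ = (∀ v → degree G v ℕ.≤ Δ) × ∃ λ v → degree G v ≡ Δ

Colouring : ℕ → ℕ → Set
Colouring n q = Fin n → Fin q

μ : ∀ {n q} → Multigraph n → Colouring n q → ℕ
μ G σ = length (filter (λ (a , b) → σ a ≟ σ b) (edges G))

⌈_/_⌉ : ∀ (m d : ℕ) .{{_ : NonZero d}} → ℕ
⌈ m / d ⌉ = (m ℕ.+ (d ℕ.∸ 1)) / d

------------------------------------------------------------------------
-- The partition function

module _ {c ℓ₁ ℓ₂} (K : OrderedField c ℓ₁ ℓ₂) where
  open OrderedField K
  open Sum +-commutativeMonoid using (sum)

  -- The sum of F σ over all σ : Fin n → Fin q, by the colour of vertex 0.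
  sumColourings : ∀ n q → (Colouring n q → Carrier) → Carrier
  sumColourings zero    q F = F Vector.[]
  sumColourings (suc n) q F =
    sum {q} λ c → sumColourings n q λ σ → F (c Vector.∷ σ)

  Z : ∀ {n} → Multigraph n → Carrier → ℕ → Carrier
  Z {n} G x q = sumColourings n q λ σ → x ^ μ G σ

------------------------------------------------------------------------
-- The extremal multigraph

2k≤n : ∀ {n m Δ} .{{_ : NonZero Δ}} (d : Δ ∣ m) →
       2 ℕ.* m / Δ ℕ.≤ n → quotient d ℕ.* 2 ℕ.≤ n
2k≤n {Δ = Δ} (divides k ≡.refl) le = subst (ℕ._≤ _) eq le
  where
  eq : 2 ℕ.* (k ℕ.* Δ) / Δ ≡ k ℕ.* 2
  eq = ≡.trans (cong (_/ Δ) (≡.sym (ℕ.*-assoc 2 k Δ)))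
         (≡.trans (m*n/n≡m (2 ℕ.* k) Δ) (ℕ.*-comm 2 k))

module _ {n : ℕ} (k : ℕ) .(le : k ℕ.* 2 ℕ.≤ n) where

  -- The i-th of k pairwise disjoint edges: it joins vertices 2i and 2i+1.
  matchingEdge : Fin k → Fin n × Fin n
  matchingEdge i = inject≤ (combine {k} {2} i 0F) le , inject≤ (combine {k} {2} i 1F) le

  private
    same : ∀ i a j b → inject≤ (combine {k} {2} i a) le ≡ inject≤ (combine j b) le →
           i ≡ j × a ≡ b
    same i a j b eq = combine-injective i a j b (inject≤-injective le le _ _ eq)

  matchingEdge-loopless : ∀ i → uncurry _≢_ (matchingEdge i)
  matchingEdge-loopless i eq with () ← proj₂ (same i 0F i 1F eq)

  matchingEdge-disjoint : ∀ {v} i j → Incident v (matchingEdge i) →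
                          Incident v (matchingEdge j) → i ≡ j
  matchingEdge-disjoint i j (inj₁ p) (inj₁ q) = proj₁ (same i 0F j 0F (≡.trans (≡.sym p) q))
  matchingEdge-disjoint i j (inj₁ p) (inj₂ q) = proj₁ (same i 0F j 1F (≡.trans (≡.sym p) q))
  matchingEdge-disjoint i j (inj₂ p) (inj₁ q) = proj₁ (same i 1F j 0F (≡.trans (≡.sym p) q))
  matchingEdge-disjoint i j (inj₂ p) (inj₂ q) = proj₁ (same i 1F j 1F (≡.trans (≡.sym p) q))

H : ∀ n m Δ .{{_ : NonZero Δ}} → Δ ∣ m → 2 ℕ.* m / Δ ℕ.≤ n → Multigraph n
H n m Δ Δ∣m 2m/Δ≤n = record
  { edges    = concatMap (λ i → replicate Δ (matchingEdge k le i)) (allFin k)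
  ; loopless = All.concat⁺ (All.map⁺ (All.universal
      (λ i → All.replicate⁺ Δ (matchingEdge-loopless k le i)) (allFin k)))
  }
  where
  k = quotient Δ∣m
  le : k ℕ.* 2 ℕ.≤ n
  le = 2k≤n Δ∣m 2m/Δ≤n

-- H n m Δ is itself a multigraph with m edges and, if m is positive,
-- maximum degree Δ.

H-numEdges : ∀ n m Δ .{{_ : NonZero Δ}} (d : Δ ∣ m) (le : 2 ℕ.* m / Δ ℕ.≤ n) →
             numEdges (H n m Δ d le) ≡ m
H-numEdges n m Δ d le =
  ≡.trans (go (allFin (quotient d)))
    (≡.trans (cong (ℕ._* Δ) (length-tabulate {n = quotient d} (λ i → i)))
      (≡.sym (_∣_.equality d)))
  where
  go : ∀ is → length (concatMap (λ i → replicate Δ (matchingEdge (quotient d) (2k≤n d le) i)) is)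
            ≡ length is ℕ.* Δ
  go []       = ≡.refl
  go (i ∷ is) = ≡.trans (length-++ (replicate Δ _))
                  (cong₂ ℕ._+_ (length-replicate Δ) (go is))

H-maxDegree : ∀ n m Δ .{{_ : NonZero Δ}} .{{_ : NonZero m}}
              (d : Δ ∣ m) (le : 2 ℕ.* m / Δ ℕ.≤ n) →
              HasMaxDegree (H n m Δ d le) Δ
H-maxDegree n m Δ d le = upper , attained d le
  where
  module _ (k : ℕ) .(le : k ℕ.* 2 ℕ.≤ n) (v : Fin n) where
    e : Fin k → Fin n × Fin n
    e = matchingEdge k le

    deg : List (Fin k) → ℕ
    deg is = length (filter (incident? v) (concatMap (λ i → replicate Δ (e i)) is))

    deg-∷ : ∀ i is → deg (i ∷ is) ≡
            length (filter (incident? v) (replicate Δ (e i))) ℕ.+ deg is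
    deg-∷ i is = ≡.trans
      (cong length (filter-++ (incident? v) (replicate Δ (e i)) _))
      (length-++ (filter (incident? v) (replicate Δ (e i))))

    hit : ∀ i is → Incident v (e i) → deg (i ∷ is) ≡ Δ ℕ.+ deg is
    hit i is p = ≡.trans (deg-∷ i is) (cong (ℕ._+ deg is)
      (≡.trans (cong length (filter-all (incident? v) (All.replicate⁺ Δ p)))
        (length-replicate Δ)))

    miss : ∀ i is → ¬ Incident v (e i) → deg (i ∷ is) ≡ deg is
    miss i is ¬p = ≡.trans (deg-∷ i is) (cong (ℕ._+ deg is)
      (cong length (filter-none (incident? v) (All.replicate⁺ Δ ¬p))))

    none : ∀ is → All (λ i → ¬ Incident v (e i)) is → deg is ≡ 0
    none []       []         = ≡.refl
    none (i ∷ is) (¬p ∷ ¬ps) = ≡.trans (miss i is ¬p) (none is ¬ps)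

    once : ∀ i is → All (i ≢_) is → Incident v (e i) → deg (i ∷ is) ≡ Δ
    once i is i∉ p = ≡.trans (hit i is p) (≡.trans
      (cong (Δ ℕ.+_) (none is (All.map
        (λ {j} i≢j q → i≢j (matchingEdge-disjoint k le i j p q)) i∉)))
      (ℕ.+-identityʳ Δ))

    bounded : ∀ is → Unique is → deg is ℕ.≤ Δ
    bounded []       []       = ℕ.z≤n
    bounded (i ∷ is) (i∉ ∷ u) with incident? v (e i)
    ... | yes p = ℕ.≤-reflexive (once i is i∉ p)
    ... | no ¬p = ℕ.≤-trans (ℕ.≤-reflexive (miss i is ¬p)) (bounded is u)

  upper : ∀ v → degree (H n m Δ d le) v ℕ.≤ Δ
  upper v = bounded (quotient d) (2k≤n d le) v (allFin _) (allFin⁺ _)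

  attained : (d : Δ ∣ m) (le : 2 ℕ.* m / Δ ℕ.≤ n) → ∃ λ v → degree (H n m Δ d le) v ≡ Δ
  attained (divides zero ≡.refl) le = contradiction ≡.refl (ℕ.≢-nonZero⁻¹ m)
  attained d@(divides (suc k) eq) le = v , at (allFin⁺ (suc k))
    where
    le′ = 2k≤n d le
    v   = proj₁ (matchingEdge (suc k) le′ Fin.zero)
    at : Unique (allFin (suc k)) → deg (suc k) le′ v (allFin (suc k)) ≡ Δ
    at (i∉ ∷ _) = once (suc k) le′ v Fin.zero _ i∉ (inj₁ ≡.refl)

{-# OPTIONS --safe #-}

-- Delete the vertices one at a time.  If the deleted vertex has d neighbours (with
-- multiplicity), of which a i have colour i, then summing over its colour contributes
-- Σᵢ x^(a i) ≤ q - 1 + x^d = q f(d), where f(d) = 1 + q⁻¹ (x^d - 1).  Hence Z is at most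
-- qⁿ Π f(dⱼ) for some dⱼ ≤ Δ with sum m.  As f is log-convex and f(0) = 1, such a product
-- only grows when as many dⱼ as possible are made equal to Δ.  On a matching of
-- Δ-fold edges every step is an equality.

module Submission where

open import Algebra.Bundles using (CommutativeMonoid; CommutativeRing)
import Algebra.Properties.CommutativeMonoid.Mult as MonoidMult
import Algebra.Properties.CommutativeMonoid.Sum as Sum
import Algebra.Properties.Ring as RingProperties
import Algebra.Properties.Semiring.Exp as Exp
import Algebra.Properties.Semiring.Mult as Mult
import Algebra.Properties.Semiring.Sum as SemiringSum
import Algebra.Solver.Ring.NaturalCoefficients.Default as Solver
open import Data.Bool.Base using (true; false; if_then_else_; _∨_)
open import Data.Fin.Base using (Fin; zero; suc)
open import Data.Fin.Properties using (_≟_)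
open import Data.List.Base using (List; []; _∷_; _++_; length; filter; map; concat; replicate; tabulate)
open import Data.List.Properties using (length-++; length-map; filter-++; map-tabulate)
open import Data.List.Relation.Unary.All using (All; []; _∷_)
open import Data.Nat.Base as ℕ using (ℕ; zero; suc; NonZero; z≤n; s≤s)
open import Data.Nat.Divisibility using (_∣_; divides)
open import Data.Nat.DivMod using (_/_; _%_; m≡m%n+[m/n]*n; m%n<n; m*n/n≡m; +-distrib-/-∣ˡ; m<n⇒m/n≡0)
import Data.Nat.Properties as ℕ
open import Data.Nat.Solver using (module +-*-Solver)
open import Data.Product.Base using (_×_; _,_; proj₁; ∃₂; uncurry)
open import Data.Sum.Base using (inj₁; inj₂)
import Data.Vec.Functional as Vector
open import Defs
open import Relation.Binary.Bundles using (Preorder)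
import Relation.Binary.Reasoning.Preorder as PreorderReasoning
import Relation.Binary.Reasoning.Setoid as SetoidReasoning
open import Relation.Binary.PropositionalEquality as ≡ using (_≡_; _≢_; cong; cong₂)
open import Relation.Nullary using (does; yes; no; contradiction)
open import Relation.Unary using (Decidable)

-- Counting entries of a list by colour.

module _ {c ℓ} (M : CommutativeMonoid c ℓ) where
  open CommutativeMonoid M
  open Sum M using (sum; sum-replicate)
  open MonoidMult M using () renaming (_×_ to _·_)
  open SetoidReasoning setoid

  -- Exactly one index hits `i`, and the other `p` all give `y`. The monoid is arbitrary because the
  -- lemma serves twice: in `ℕ` for counting, and in the field for summing over the colour of one
  -- end of an edge.
  sum-if-≟ : ∀ {p} (i : Fin (suc p)) {x y} →
             sum (λ j → if does (i ≟ j) then x else y) ≈ x ∙ (p · y)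
  sum-if-≟ {p}     zero            = ∙-congˡ (sum-replicate p)
  sum-if-≟ {suc p} (suc i) {x} {y} = begin
    y ∙ sum (λ j → if does (i ≟ j) then x else y) ≈⟨ ∙-congˡ (sum-if-≟ i) ⟩
    y ∙ (x ∙ (p · y))                             ≈⟨ assoc y x _ ⟨
    (y ∙ x) ∙ (p · y)                             ≈⟨ ∙-congʳ (comm y x) ⟩
    (x ∙ y) ∙ (p · y)                             ≈⟨ assoc x y _ ⟩
    x ∙ (y ∙ (p · y))                             ∎

module ℕΣ = Sum ℕ.+-0-commutativeMonoid

multiplicity : ∀ {q} → Fin q → List (Fin q) → ℕ
multiplicity i is = length (filter (i ≟_) is)

-- Every entry is counted at exactly one colour.
sum-multiplicity : ∀ {q} (is : List (Fin q)) → ℕΣ.sum (λ i → multiplicity i is) ≡ length is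
sum-multiplicity {q} []       = ℕΣ.sum-replicate-zero q
sum-multiplicity {suc p} (j ∷ is) = begin
  ℕΣ.sum (λ i → multiplicity i (j ∷ is))
    ≡⟨ ℕΣ.sum-cong-≗ step ⟩
  ℕΣ.sum (λ i → (if does (j ≟ i) then 1 else 0) ℕ.+ multiplicity i is)
    ≡⟨ ℕΣ.∑-distrib-+ (λ i → if does (j ≟ i) then 1 else 0) (λ i → multiplicity i is) ⟩
  ℕΣ.sum (λ i → if does (j ≟ i) then 1 else 0) ℕ.+ ℕΣ.sum (λ i → multiplicity i is)
    ≡⟨ cong₂ ℕ._+_ (≡.trans (sum-if-≟ ℕ.+-0-commutativeMonoid j)
                     (cong suc (≡.trans (≡.sym (ℕΣ.sum-replicate p {0})) (ℕΣ.sum-replicate-zero p))))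
         (sum-multiplicity is) ⟩
  suc (length is) ∎
  where
  open ≡.≡-Reasoning

  step : ∀ i → multiplicity i (j ∷ is) ≡ (if does (j ≟ i) then 1 else 0) ℕ.+ multiplicity i is
  -- `multiplicity` compares `i` with `j`, while `sum-if-≟` compares `j` with `i`, so the two
  -- decisions have to be reconciled.
  step i with i ≟ j | j ≟ i
  ... | yes _   | yes _   = ≡.refl
  ... | no _    | no _    = ≡.refl
  ... | yes i≡j | no j≢i  = contradiction (≡.sym i≡j) j≢i
  ... | no i≢j  | yes j≡i = contradiction (≡.sym j≡i) i≢j

-- Deleting vertex `zero` from an edge list.

Edges : ℕ → Set
Edges n = List (Fin n × Fin n)

Loopless : ∀ {n} → Edges n → Set
Loopless = All (uncurry _≢_)

deg : ∀ {n} → Edges n → Fin n → ℕ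
deg es v = length (filter (incident? v) es)

monochromatic : ∀ {n q} → Edges n → Colouring n q → ℕ
monochromatic es σ = length (filter (λ (a , b) → σ a ≟ σ b) es)

-- Parallel edges repeat a neighbour, so the length is a degree. The value at a loop is arbitrary:
-- loops are ruled out wherever the exact count matters.
neighbours : ∀ {n} → Edges (suc n) → List (Fin n)
neighbours []                     = []
neighbours ((zero  , zero)  ∷ es) = neighbours es
neighbours ((zero  , suc b) ∷ es) = b ∷ neighbours es
neighbours ((suc a , zero)  ∷ es) = a ∷ neighbours es
neighbours ((suc a , suc b) ∷ es) = neighbours es

delete : ∀ {n} → Edges (suc n) → Edges n
delete []                     = []
delete ((zero  , zero)  ∷ es) = delete es
delete ((zero  , suc b) ∷ es) = delete es
delete ((suc a , zero)  ∷ es) = delete es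
delete ((suc a , suc b) ∷ es) = (a , b) ∷ delete es

delete-loopless : ∀ {n} {es : Edges (suc n)} → Loopless es → Loopless (delete es)
delete-loopless []                                   = []
delete-loopless (_∷_ {zero  , zero}  0≢0 loopless)   = contradiction ≡.refl 0≢0
delete-loopless (_∷_ {zero  , suc b} _ loopless)     = delete-loopless loopless
delete-loopless (_∷_ {suc a , zero}  _ loopless)     = delete-loopless loopless
delete-loopless (_∷_ {suc a , suc b} a≢b loopless)   =
  (λ a≡b → a≢b (cong suc a≡b)) ∷ delete-loopless loopless

-- An edge that is not a loop has either one end at `zero`, and yields a neighbour, or none, and
-- survives.
length-neighbours-delete : ∀ {n} {es : Edges (suc n)} → Loopless es →
                           length (neighbours es) ℕ.+ length (delete es) ≡ length es
length-neighbours-delete []                                 = ≡.refl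
length-neighbours-delete (_∷_ {zero  , zero}  0≢0 loopless) = contradiction ≡.refl 0≢0
length-neighbours-delete (_∷_ {zero  , suc b} _ loopless)   = cong suc (length-neighbours-delete loopless)
length-neighbours-delete (_∷_ {suc a , zero}  _ loopless)   = cong suc (length-neighbours-delete loopless)
length-neighbours-delete (_∷_ {suc a , suc b} _ loopless)   =
  ≡.trans (ℕ.+-suc _ _) (cong suc (length-neighbours-delete loopless))

length-neighbours≤deg : ∀ {n} (es : Edges (suc n)) → length (neighbours es) ℕ.≤ deg es zero
length-neighbours≤deg []                     = z≤n
length-neighbours≤deg ((zero  , zero)  ∷ es) = ℕ.m≤n⇒m≤1+n (length-neighbours≤deg es)
length-neighbours≤deg ((zero  , suc b) ∷ es) = s≤s (length-neighbours≤deg es)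
length-neighbours≤deg ((suc a , zero)  ∷ es) = s≤s (length-neighbours≤deg es)
length-neighbours≤deg ((suc a , suc b) ∷ es) = length-neighbours≤deg es

-- This keeps the degree bound valid as the induction deletes vertices.
deg-delete≤deg : ∀ {n} (es : Edges (suc n)) v → deg (delete es) v ℕ.≤ deg es (suc v)
deg-delete≤deg []                     v = z≤n
deg-delete≤deg ((zero  , zero)  ∷ es) v = deg-delete≤deg es v
deg-delete≤deg ((zero  , suc b) ∷ es) v with does (v ≟ b)
... | true  = ℕ.m≤n⇒m≤1+n (deg-delete≤deg es v)
... | false = deg-delete≤deg es v
deg-delete≤deg ((suc a , zero)  ∷ es) v with does (v ≟ a)
... | true  = ℕ.m≤n⇒m≤1+n (deg-delete≤deg es v)
... | false = deg-delete≤deg es v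
deg-delete≤deg ((suc a , suc b) ∷ es) v with does (v ≟ a) ∨ does (v ≟ b)
... | true  = s≤s (deg-delete≤deg es v)
... | false = deg-delete≤deg es v

-- An edge at `zero` is monochromatic when its other end has colour `i`; all other edges see only
-- `σ`. The weight of a colouring thus factors, and only one factor depends on the colour of the
-- deleted vertex.
monochromatic-∷ : ∀ {n q} {es : Edges (suc n)} → Loopless es → (i : Fin q) (σ : Colouring n q) →
                  monochromatic es (i Vector.∷ σ) ≡
                  multiplicity i (map σ (neighbours es)) ℕ.+ monochromatic (delete es) σ
monochromatic-∷ [] i σ = ≡.refl
monochromatic-∷ (_∷_ {zero , zero}  0≢0 loopless) i σ = contradiction ≡.refl 0≢0
monochromatic-∷ (_∷_ {zero , suc b} _ loopless) i σ with does (i ≟ σ b)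
... | true  = cong suc (monochromatic-∷ loopless i σ)
... | false = monochromatic-∷ loopless i σ
monochromatic-∷ (_∷_ {suc a , zero} _ loopless) i σ with σ a ≟ i | i ≟ σ a
... | yes _   | yes _   = cong suc (monochromatic-∷ loopless i σ)
... | no _    | no _    = monochromatic-∷ loopless i σ
... | yes p   | no ¬p   = contradiction (≡.sym p) ¬p
... | no ¬p   | yes p   = contradiction (≡.sym p) ¬p
monochromatic-∷ (_∷_ {suc a , suc b} _ loopless) i σ with does (σ a ≟ σ b)
... | true  = ≡.trans (cong suc (monochromatic-∷ loopless i σ)) (≡.sym (ℕ.+-suc _ _))
... | false = monochromatic-∷ loopless i σ

-- Monochromatic edges of a matching of `Δ`-fold edges.

length-filter-replicate : ∀ {a p} {A : Set a} {P : A → Set p} (P? : Decidable P) Δ x →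
                          length (filter P? (replicate Δ x)) ≡ (if does (P? x) then Δ else 0)
length-filter-replicate P? zero    x with does (P? x)
... | true  = ≡.refl
... | false = ≡.refl
length-filter-replicate P? (suc Δ) x with does (P? x) | length-filter-replicate P? Δ x
... | true  | ih = cong suc ih
... | false | ih = ih

length-filter-replicates : ∀ {a p} {A : Set a} {P : A → Set p} (P? : Decidable P) Δ k (f : Fin k → A) →
  length (filter P? (concat (tabulate (λ i → replicate Δ (f i))))) ≡
  ℕΣ.sum (λ i → if does (P? (f i)) then Δ else 0)
length-filter-replicates P? Δ zero    f = ≡.refl
length-filter-replicates P? Δ (suc k) f = begin
  length (filter P? (replicate Δ (f zero) ++ rest))
    ≡⟨ cong length (filter-++ P? (replicate Δ (f zero)) rest) ⟩
  length (filter P? (replicate Δ (f zero)) ++ filter P? rest)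
    ≡⟨ length-++ (filter P? (replicate Δ (f zero))) ⟩
  length (filter P? (replicate Δ (f zero))) ℕ.+ length (filter P? rest)
    ≡⟨ cong₂ ℕ._+_ (length-filter-replicate P? Δ (f zero))
                   (length-filter-replicates P? Δ k (λ i → f (suc i))) ⟩
  ℕΣ.sum (λ i → if does (P? (f i)) then Δ else 0) ∎
  where
  open ≡.≡-Reasoning
  rest = concat (tabulate (λ i → replicate Δ (f (suc i))))

-- A sum over the edges of the matching, instead of a filtered list, lets the first edge be split
-- off by computation.
matchingMonochromatic : ∀ {n q} Δ k → .(k ℕ.* 2 ℕ.≤ n) → Colouring n q → ℕ
matchingMonochromatic Δ k le σ =
  ℕΣ.sum (λ i → let (a , b) = matchingEdge k le i in if does (σ a ≟ σ b) then Δ else 0)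

μ-H : ∀ {n q} m Δ .{{_ : NonZero Δ}} (Δ∣m : Δ ∣ m) (le : 2 ℕ.* m / Δ ℕ.≤ n) (σ : Colouring n q) →
      μ (H n m Δ Δ∣m le) σ ≡ matchingMonochromatic Δ (_∣_.quotient Δ∣m) (2k≤n Δ∣m le) σ
μ-H m Δ Δ∣m le σ =
  ≡.trans (cong (λ ess → length (filter (λ (a , b) → σ a ≟ σ b) (concat ess)))
            (map-tabulate {n = k} (λ i → i) _))
    (length-filter-replicates (λ (a , b) → σ a ≟ σ b) Δ k (matchingEdge k (2k≤n Δ∣m le)))
  where k = _∣_.quotient Δ∣m

-- Ceiling division.

m≤⌈m/d⌉*d : ∀ m d .{{_ : NonZero d}} → m ℕ.≤ ⌈ m / d ⌉ ℕ.* d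
m≤⌈m/d⌉*d m d@(suc d′) = ℕ.+-cancelʳ-≤ d′ m _ (begin
  m ℕ.+ d′                                     ≡⟨ m≡m%n+[m/n]*n (m ℕ.+ d′) d ⟩
  -- The remainder is at most `d′`, which is what was added for rounding up, so it can be cancelled.
  (m ℕ.+ d′) % d ℕ.+ ⌈ m / d ⌉ ℕ.* d           ≤⟨ ℕ.+-monoˡ-≤ _ (ℕ.s≤s⁻¹ (m%n<n (m ℕ.+ d′) d)) ⟩
  d′ ℕ.+ ⌈ m / d ⌉ ℕ.* d                       ≡⟨ ℕ.+-comm d′ _ ⟩
  ⌈ m / d ⌉ ℕ.* d ℕ.+ d′                       ∎)
  where open ℕ.≤-Reasoning

⌈k*d/d⌉≡k : ∀ k d .{{_ : NonZero d}} → ⌈ k ℕ.* d / d ⌉ ≡ k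
⌈k*d/d⌉≡k k d@(suc d′) = begin
  (k ℕ.* d ℕ.+ d′) / d      ≡⟨ +-distrib-/-∣ˡ d′ (divides k ≡.refl) ⟩
  k ℕ.* d / d ℕ.+ d′ / d    ≡⟨ cong₂ ℕ._+_ (m*n/n≡m k d) (m<n⇒m/n≡0 (ℕ.n<1+n d′)) ⟩
  k ℕ.+ 0                   ≡⟨ ℕ.+-identityʳ k ⟩
  k                         ∎
  where open ≡.≡-Reasoning

module _ {c ℓ₁ ℓ₂} (K : OrderedField c ℓ₁ ℓ₂) where
  open OrderedField K hiding (zero)
  open Sum +-commutativeMonoid using (sum; sum-cong-≋; ∑-comm; sum-replicate)
  open Exp semiring using (^-homo-*; ^-congʳ)
  open Mult semiring using (×-assoc-*; ×-congʳ)
  open SemiringSum semiring using (*-distribˡ-sum; *-distribʳ-sum)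
  open RingProperties ring using (xyx⁻¹≈y; -‿distribˡ-*)
  open CommutativeRing commutativeRing using (commutativeSemiring)
  open Solver commutativeSemiring using (solve; _:=_; _:+_; _:*_; con)

  -- Order arithmetic in the field.

  ≤-reflexive : ∀ {x y} → x ≈ y → x ≤ y
  ≤-reflexive x≈y y<x = <-irrefl (sym x≈y) y<x

  -- As `≤` is a negation, `z < x` may be assumed. Cotransitivity then places `y` strictly above or
  -- below `z` or `x`, and each case contradicts a hypothesis.
  ≤-trans : ∀ {x y z} → x ≤ y → y ≤ z → x ≤ z
  ≤-trans {y = y} x≤y y≤z z<x with #-cotrans (inj₁ z<x) y
  ... | inj₁ (inj₁ z<y) = y≤z z<y
  ... | inj₁ (inj₂ y<z) = x≤y (<-trans y<z z<x)
  ... | inj₂ (inj₁ y<x) = x≤y y<x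
  ... | inj₂ (inj₂ x<y) = y≤z (<-trans z<x x<y)

  ≤-preorder : Preorder c ℓ₁ ℓ₂
  ≤-preorder = record
    { _≈_        = _≈_
    ; _≲_        = _≤_
    ; isPreorder = record
      { isEquivalence = isEquivalence
      ; reflexive     = ≤-reflexive
      ; trans         = ≤-trans
      }
    }

  open PreorderReasoning ≤-preorder

  x+[y-x]≈y : ∀ x y → x + (y - x) ≈ y
  x+[y-x]≈y x y = trans (sym (+-assoc x y (- x))) (xyx⁻¹≈y x y)

  +-monoˡ-≤ : ∀ {x y} z → x ≤ y → x + z ≤ y + z
  +-monoˡ-≤ {x} {y} z x≤y y+z<x+z = x≤y
    (<-respˡ-≈ (cancel y) (<-respʳ-≈ (cancel x) (+-monoˡ-< (- z) y+z<x+z)))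
    where
    cancel : ∀ w → (w + z) - z ≈ w
    cancel w = trans (+-assoc w z (- z)) (trans (+-congˡ (-‿inverseʳ z)) (+-identityʳ w))

  +-mono-≤ : ∀ {w x y z} → w ≤ x → y ≤ z → w + y ≤ x + z
  +-mono-≤ {w} {x} {y} {z} w≤x y≤z = begin
    w + y ≲⟨ +-monoˡ-≤ y w≤x ⟩
    x + y ≈⟨ +-comm x y ⟩
    y + x ≲⟨ +-monoˡ-≤ x y≤z ⟩
    z + x ≈⟨ +-comm z x ⟩
    x + z ∎

  x≤y⇒0≤y-x : ∀ {x y} → x ≤ y → 0# ≤ y - x
  x≤y⇒0≤y-x {x} {y} x≤y = ≤-trans (≤-reflexive (sym (-‿inverseʳ x))) (+-monoˡ-≤ (- x) x≤y)

  x≤x+y : ∀ {x y} → 0# ≤ y → x ≤ x + y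
  x≤x+y {x} 0≤y = ≤-trans (≤-reflexive (sym (+-identityʳ x))) (+-mono-≤ (≤-reflexive refl) 0≤y)

  +-nonneg : ∀ {x y} → 0# ≤ x → 0# ≤ y → 0# ≤ x + y
  +-nonneg 0≤x 0≤y = ≤-trans 0≤x (x≤x+y 0≤y)

  -- The goal is a negation, so both factors may be assumed to be apart from 0# by tightness.
  *-nonneg : ∀ {x y} → 0# ≤ x → 0# ≤ y → 0# ≤ x * y
  *-nonneg {x} {y} 0≤x 0≤y xy<0 = <-irrefl xy≈0 xy<0
    where
    y≈0 : 0# < x → y ≈ 0#
    y≈0 0<x = proj₁ (tight y 0#)
      λ { (inj₁ y<0) → 0≤y y<0
        ; (inj₂ 0<y) → <-asym xy<0 (*-pos 0<x 0<y) }

    x≈0 : x ≈ 0#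
    x≈0 = proj₁ (tight x 0#)
      λ { (inj₁ x<0) → 0≤x x<0
        ; (inj₂ 0<x) → <-irrefl (trans (*-congˡ (y≈0 0<x)) (zeroʳ x)) xy<0 }

    xy≈0 : x * y ≈ 0#
    xy≈0 = trans (*-congʳ x≈0) (zeroˡ y)

  *-monoʳ-≤ : ∀ {x y z} → 0# ≤ z → x ≤ y → z * x ≤ z * y
  *-monoʳ-≤ {x} {y} {z} 0≤z x≤y = begin
    z * x               ≲⟨ x≤x+y (*-nonneg 0≤z (x≤y⇒0≤y-x x≤y)) ⟩
    z * x + z * (y - x) ≈⟨ distribˡ z x (y - x) ⟨
    z * (x + (y - x))   ≈⟨ *-congˡ (x+[y-x]≈y x y) ⟩
    z * y               ∎

  *-monoˡ-≤ : ∀ {x y z} → 0# ≤ z → x ≤ y → x * z ≤ y * z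
  *-monoˡ-≤ {x} {y} {z} 0≤z x≤y = begin
    x * z ≈⟨ *-comm x z ⟩
    z * x ≲⟨ *-monoʳ-≤ 0≤z x≤y ⟩
    z * y ≈⟨ *-comm z y ⟩
    y * z ∎

  0≤1 : 0# ≤ 1#
  0≤1 1<0 = <-asym 0<1 1<0

  1≤⇒0≤ : ∀ {x} → 1# ≤ x → 0# ≤ x
  1≤⇒0≤ = ≤-trans 0≤1

  1≤* : ∀ {x y} → 1# ≤ x → 1# ≤ y → 1# ≤ x * y
  1≤* {x} {y} 1≤x 1≤y = begin
    1#     ≲⟨ 1≤x ⟩
    x      ≈⟨ *-identityʳ x ⟨
    x * 1# ≲⟨ *-monoʳ-≤ (1≤⇒0≤ 1≤x) 1≤y ⟩
    x * y  ∎

  1≤^ : ∀ {x} k → 1# ≤ x → 1# ≤ x ^ k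
  1≤^ zero    1≤x = ≤-reflexive refl
  1≤^ (suc k) 1≤x = 1≤* 1≤x (1≤^ k 1≤x)

  0≤fromℕ : ∀ k → 0# ≤ fromℕ k
  0≤fromℕ zero    = ≤-reflexive refl
  0≤fromℕ (suc k) = +-nonneg 0≤1 (0≤fromℕ k)

  -- If the inverse were negative, multiplying its negation by the positive `fromℕ k` would make
  -- `- 1#` positive.
  0≤⁻¹ : ∀ k .{{_ : NonZero k}} → 0# ≤ k ⁻¹
  0≤⁻¹ k k⁻¹<0 = <-asym 0<1
    (<-respˡ-≈ (+-identityˡ 1#) (<-respʳ-≈ -1+1≈0 (+-monoˡ-< 1# 0<-1)))
    where
    -1+1≈0 : - 1# + 1# ≈ 0#
    -1+1≈0 = -‿inverseˡ 1#

    0<-k⁻¹ : 0# < - (k ⁻¹)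
    0<-k⁻¹ = <-respˡ-≈ (-‿inverseʳ (k ⁻¹)) (<-respʳ-≈ (+-identityˡ _) (+-monoˡ-< (- (k ⁻¹)) k⁻¹<0))

    0<-1 : 0# < - 1#
    0<-1 = <-respʳ-≈
      (trans (sym (-‿distribˡ-* (k ⁻¹) (fromℕ k))) (-‿cong (⁻¹-inverse k)))
      (*-pos 0<-k⁻¹ (0<fromℕ k))

  fromℕ-* : ∀ k x → k · x ≈ fromℕ k * x
  fromℕ-* k x = trans (×-congʳ k (sym (*-identityˡ x))) (sym (×-assoc-* k 1# x))

  -- Sums over colourings.

  sumColourings-cong : ∀ n {q} {F G : Colouring n q → Carrier} →
    (∀ σ → F σ ≈ G σ) → sumColourings K n q F ≈ sumColourings K n q G
  sumColourings-cong zero    F≈G = F≈G _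
  sumColourings-cong (suc n) F≈G = sum-cong-≋ λ i → sumColourings-cong n λ σ → F≈G (i Vector.∷ σ)

  sum-mono-≤ : ∀ {n} {f g : Fin n → Carrier} → (∀ i → f i ≤ g i) → sum f ≤ sum g
  sum-mono-≤ {zero}  f≤g = ≤-reflexive refl
  sum-mono-≤ {suc n} f≤g = +-mono-≤ (f≤g zero) (sum-mono-≤ (λ i → f≤g (suc i)))

  sumColourings-mono-≤ : ∀ n {q} {F G : Colouring n q → Carrier} →
    (∀ σ → F σ ≤ G σ) → sumColourings K n q F ≤ sumColourings K n q G
  sumColourings-mono-≤ zero    F≤G = F≤G _
  sumColourings-mono-≤ (suc n) F≤G = sum-mono-≤ λ i → sumColourings-mono-≤ n λ σ → F≤G (i Vector.∷ σ)

  *-distribˡ-sumColourings : ∀ n {q} x (F : Colouring n q → Carrier) →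
    x * sumColourings K n q F ≈ sumColourings K n q (λ σ → x * F σ)
  *-distribˡ-sumColourings zero    x F = refl
  *-distribˡ-sumColourings (suc n) {q} x F = begin-equality
    x * sum (λ i → sumColourings K n q (λ σ → F (i Vector.∷ σ)))
      ≈⟨ *-distribˡ-sum x (λ i → sumColourings K n q (λ σ → F (i Vector.∷ σ))) ⟩
    sum (λ i → x * sumColourings K n q (λ σ → F (i Vector.∷ σ)))
      ≈⟨ sum-cong-≋ (λ i → *-distribˡ-sumColourings n x (λ σ → F (i Vector.∷ σ))) ⟩
    sum (λ i → sumColourings K n q (λ σ → x * F (i Vector.∷ σ))) ∎

  -- This moves the sum over the colour of the deleted vertex innermost, where the colouring of the
  -- other vertices is fixed.
  sum-sumColourings-comm : ∀ {p} n {q} (F : Fin p → Colouring n q → Carrier) →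
    sum (λ i → sumColourings K n q (F i)) ≈ sumColourings K n q (λ σ → sum (λ i → F i σ))
  sum-sumColourings-comm     zero    F = refl
  sum-sumColourings-comm {p} (suc n) {q} F = begin-equality
    sum (λ i → sum (λ j → sumColourings K n q (λ σ → F i (j Vector.∷ σ))))
      ≈⟨ ∑-comm (λ i j → sumColourings K n q (λ σ → F i (j Vector.∷ σ))) ⟩
    sum (λ j → sum (λ i → sumColourings K n q (λ σ → F i (j Vector.∷ σ))))
      ≈⟨ sum-cong-≋ (λ j → sum-sumColourings-comm n (λ i σ → F i (j Vector.∷ σ))) ⟩
    sum (λ j → sumColourings K n q (λ σ → sum (λ i → F i (j Vector.∷ σ)))) ∎

  sumColourings-1 : ∀ n q → sumColourings K n q (λ _ → 1#) ≈ fromℕ q ^ n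
  sumColourings-1 zero    q = refl
  sumColourings-1 (suc n) q = begin-equality
    sum {q} (λ _ → sumColourings K n q (λ _ → 1#)) ≈⟨ sum-replicate q ⟩
    q · sumColourings K n q (λ _ → 1#)             ≈⟨ fromℕ-* q _ ⟩
    fromℕ q * sumColourings K n q (λ _ → 1#)       ≈⟨ *-congˡ (sumColourings-1 n q) ⟩
    fromℕ q * fromℕ q ^ n                          ∎

  -- Sums of powers of a base that is at least one.

  x≈1+[x-1] : ∀ x → x ≈ 1# + (x - 1#)
  x≈1+[x-1] x = sym (x+[y-x]≈y 1# x)

  0≤x^d-1 : ∀ {x} → 1# ≤ x → ∀ d → 0# ≤ x ^ d - 1#
  0≤x^d-1 1≤x d = x≤y⇒0≤y-x (1≤^ d 1≤x)

  -- The extreme case puts the whole exponent on one colour. Exponents are merged one at a time: for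
  -- `A` and `B` nonnegative, the sum of `1 + A` and `1 + B` is at most one plus their product, with
  -- slack `A * B`.
  sum-^≤ : ∀ {x} → 1# ≤ x → ∀ p (a : Fin (suc p) → ℕ) → sum (λ i → x ^ a i) ≤ fromℕ p + x ^ ℕΣ.sum a
  sum-^≤ {x} 1≤x zero a = ≤-reflexive (begin-equality
    x ^ a zero + 0#           ≈⟨ +-comm _ 0# ⟩
    0# + x ^ a zero           ≡⟨ cong (λ i → 0# + x ^ i) (ℕ.+-identityʳ (a zero)) ⟨
    0# + x ^ (a zero ℕ.+ 0)   ∎)
  sum-^≤ {x} 1≤x (suc p) a = begin
    x ^ a zero + sum (λ i → x ^ a (suc i))
      ≲⟨ +-mono-≤ (≤-reflexive refl) (sum-^≤ 1≤x p (λ i → a (suc i))) ⟩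
    x ^ a zero + (fromℕ p + x ^ b)
      -- Taking the excesses over one as atoms makes the identity below free of subtraction, so the
      -- semiring solver applies.
      ≈⟨ +-cong (x≈1+[x-1] _) (+-congˡ (x≈1+[x-1] _)) ⟩
    (1# + A) + (fromℕ p + (1# + B))
      ≲⟨ x≤x+y (*-nonneg (0≤x^d-1 1≤x (a zero)) (0≤x^d-1 1≤x b)) ⟩
    (1# + A) + (fromℕ p + (1# + B)) + A * B
      ≈⟨ solve 3 (λ A B P → (con 1 :+ A) :+ (P :+ (con 1 :+ B)) :+ A :* B
                           := (con 1 :+ P) :+ (con 1 :+ A) :* (con 1 :+ B)) refl A B (fromℕ p) ⟩
    fromℕ (suc p) + (1# + A) * (1# + B)
      ≈⟨ +-congˡ (*-cong (x≈1+[x-1] _) (x≈1+[x-1] _)) ⟨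
    fromℕ (suc p) + x ^ a zero * x ^ b
      ≈⟨ +-congˡ (^-homo-* x (a zero) b) ⟨
    fromℕ (suc p) + x ^ ℕΣ.sum a ∎
    where
    b = ℕΣ.sum (λ i → a (suc i))
    A = x ^ a zero - 1#
    B = x ^ b - 1#

  -- The factor `f` of one vertex, for `suc p` colours.

  module _ (p : ℕ) (x : Carrier) (1≤x : 1# ≤ x) where

    Q : Carrier
    Q = fromℕ (suc p)

    f : ℕ → Carrier
    f d = 1# + suc p ⁻¹ * (x ^ d - 1#)

    1≤f : ∀ d → 1# ≤ f d
    1≤f d = x≤x+y (*-nonneg (0≤⁻¹ (suc p)) (0≤x^d-1 1≤x d))

    Q*f : ∀ d → Q * f d ≈ fromℕ p + x ^ d
    Q*f d = begin-equality
      Q * (1# + suc p ⁻¹ * (x ^ d - 1#))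
        ≈⟨ solve 3 (λ Q v s → Q :* (con 1 :+ v :* s) := Q :+ (v :* Q) :* s) refl Q (suc p ⁻¹) _ ⟩
      Q + (suc p ⁻¹ * Q) * (x ^ d - 1#)
        ≈⟨ +-congˡ (trans (*-congʳ (⁻¹-inverse (suc p))) (*-identityˡ _)) ⟩
      1# + fromℕ p + (x ^ d - 1#)
        ≈⟨ solve 2 (λ p s → con 1 :+ p :+ s := p :+ (con 1 :+ s)) refl (fromℕ p) _ ⟩
      fromℕ p + (1# + (x ^ d - 1#))
        ≈⟨ +-congˡ (x+[y-x]≈y 1# (x ^ d)) ⟩
      fromℕ p + x ^ d ∎

    -- This form has no subtraction, which suits the expansion in `f-logConvex`.
    f≈ : ∀ d → f d ≈ suc p ⁻¹ * (fromℕ p + x ^ d)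
    f≈ d = begin-equality
      f d                          ≈⟨ *-identityˡ _ ⟨
      1# * f d                     ≈⟨ *-congʳ (⁻¹-inverse (suc p)) ⟨
      suc p ⁻¹ * Q * f d           ≈⟨ *-assoc _ _ _ ⟩
      suc p ⁻¹ * (Q * f d)         ≈⟨ *-congˡ (Q*f d) ⟩
      suc p ⁻¹ * (fromℕ p + x ^ d) ∎

    -- In the notation of the proof, the right side exceeds the left by exactly
    -- `v * v * (P * X) * (S * T)`, a product of nonnegative factors.
    f-logConvex : ∀ e s t → f (e ℕ.+ s) * f (e ℕ.+ t) ≤ f (e ℕ.+ (s ℕ.+ t)) * f e
    f-logConvex e s t = begin
      f (e ℕ.+ s) * f (e ℕ.+ t)
        ≈⟨ *-cong (f≈+ s) (f≈+ t) ⟩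
      (v * (P + X * x ^ s)) * (v * (P + X * x ^ t))
        ≈⟨ *-cong (*-congˡ (+-congˡ (*-congˡ (x≈1+[x-1] _)))) (*-congˡ (+-congˡ (*-congˡ (x≈1+[x-1] _)))) ⟩
      (v * (P + X * (1# + S))) * (v * (P + X * (1# + T)))
        ≲⟨ x≤x+y (*-nonneg (*-nonneg (*-nonneg 0≤v 0≤v) (*-nonneg (0≤fromℕ p) (1≤⇒0≤ (1≤^ e 1≤x))))
                   (*-nonneg (0≤x^d-1 1≤x s) (0≤x^d-1 1≤x t))) ⟩
      (v * (P + X * (1# + S))) * (v * (P + X * (1# + T))) + v * v * (P * X) * (S * T)
        ≈⟨ solve 5 (λ v P X S T →
             (v :* (P :+ X :* (con 1 :+ S))) :* (v :* (P :+ X :* (con 1 :+ T))) :+ v :* v :* (P :* X) :* (S :* T)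
             := (v :* (P :+ X :* ((con 1 :+ S) :* (con 1 :+ T)))) :* (v :* (P :+ X)))
           refl v P X S T ⟩
      (v * (P + X * ((1# + S) * (1# + T)))) * (v * (P + X))
        ≈⟨ *-congʳ (*-congˡ (+-congˡ (*-congˡ (*-cong (x≈1+[x-1] _) (x≈1+[x-1] _))))) ⟨
      (v * (P + X * (x ^ s * x ^ t))) * (v * (P + X))
        ≈⟨ *-congʳ (*-congˡ (+-congˡ (*-congˡ (^-homo-* x s t)))) ⟨
      (v * (P + X * x ^ (s ℕ.+ t))) * (v * (P + X))
        ≈⟨ *-cong (f≈+ (s ℕ.+ t)) (f≈ e) ⟨
      f (e ℕ.+ (s ℕ.+ t)) * f e ∎
      where
      v = suc p ⁻¹
      P = fromℕ p
      X = x ^ e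
      S = x ^ s - 1#
      T = x ^ t - 1#

      0≤v : 0# ≤ v
      0≤v = 0≤⁻¹ (suc p)

      f≈+ : ∀ d → f (e ℕ.+ d) ≈ v * (P + X * x ^ d)
      f≈+ d = trans (f≈ (e ℕ.+ d)) (*-congˡ (+-congˡ (^-homo-* x e d)))

    f0≈1 : f 0 ≈ 1#
    f0≈1 = trans (+-congˡ (trans (*-congˡ (-‿inverseʳ 1#)) (zeroʳ _))) (+-identityʳ 1#)

    -- f Δ ^ k * f r is the bound for at most kΔ + r edges.  If d > r, one factor f Δ
    -- is broken up, leaving the remainder r + Δ - d.
    peel : ∀ {Δ d r m} k → d ℕ.≤ Δ → r ℕ.≤ Δ → d ℕ.+ m ℕ.≤ k ℕ.* Δ ℕ.+ r →
           ∃₂ λ k′ r′ → r′ ℕ.≤ Δ × m ℕ.≤ k′ ℕ.* Δ ℕ.+ r′ ×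
                        f d * (f Δ ^ k′ * f r′) ≤ f Δ ^ k * f r
    peel {Δ} {d} {r} {m} k d≤Δ r≤Δ d+m≤ with d ℕ.≤? r
    ... | yes d≤r = k , r ℕ.∸ d , ℕ.≤-trans (ℕ.m∸n≤m r d) r≤Δ , m≤ , bound
      where
      m≤ : m ℕ.≤ k ℕ.* Δ ℕ.+ (r ℕ.∸ d)
      m≤ = ℕ.≤-trans (ℕ.m+n≤o⇒m≤o∸n m (ℕ.≤-trans (ℕ.≤-reflexive (ℕ.+-comm m d)) d+m≤))
             (ℕ.≤-reflexive (ℕ.+-∸-assoc (k ℕ.* Δ) d≤r))

      bound : f d * (f Δ ^ k * f (r ℕ.∸ d)) ≤ f Δ ^ k * f r
      bound = begin
        f d * (f Δ ^ k * f (r ℕ.∸ d))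
          ≈⟨ solve 3 (λ a b c → a :* (b :* c) := b :* (a :* c)) refl (f d) (f Δ ^ k) (f (r ℕ.∸ d)) ⟩
        f Δ ^ k * (f d * f (r ℕ.∸ d))
          -- Log-convexity from base point 0 says that `f` is supermultiplicative, because `f 0` is
          -- one.
          ≲⟨ *-monoʳ-≤ (1≤⇒0≤ (1≤^ k (1≤f Δ))) (f-logConvex 0 d (r ℕ.∸ d)) ⟩
        f Δ ^ k * (f (d ℕ.+ (r ℕ.∸ d)) * f 0)
          ≈⟨ *-congˡ (trans (*-congˡ f0≈1) (*-identityʳ _)) ⟩
        f Δ ^ k * f (d ℕ.+ (r ℕ.∸ d))
          ≡⟨ cong (λ i → f Δ ^ k * f i) (ℕ.m+[n∸m]≡n d≤r) ⟩
        f Δ ^ k * f r ∎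
    -- With no full factor to break up, `d + m` is at most `r`, against `d > r`.
    peel {d = d} {m = m} zero d≤Δ r≤Δ d+m≤ | no d≰r = contradiction (ℕ.m+n≤o⇒m≤o d d+m≤) d≰r
    peel {Δ} {d} {r} {m} (suc k) d≤Δ r≤Δ d+m≤ | no d≰r =
      k , r ℕ.+ t , r+t≤Δ , ℕ.+-cancelˡ-≤ d m _ d+m≤d+ , bound
      where
      -- The exponents `d` and `r + t` are `r + s` and `r + t`, and `Δ` is `r + (s + t)`;
      -- log-convexity at base point `r` spreads the pair apart to `Δ` and `r`.
      s t : ℕ
      s = d ℕ.∸ r
      t = Δ ℕ.∸ d

      r+s≡d : r ℕ.+ s ≡ d
      r+s≡d = ℕ.m+[n∸m]≡n (ℕ.≰⇒≥ d≰r)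

      d+t≡Δ : d ℕ.+ t ≡ Δ
      d+t≡Δ = ℕ.m+[n∸m]≡n d≤Δ

      r+[s+t]≡Δ : r ℕ.+ (s ℕ.+ t) ≡ Δ
      r+[s+t]≡Δ = ≡.trans (≡.sym (ℕ.+-assoc r s t)) (≡.trans (cong (ℕ._+ t) r+s≡d) d+t≡Δ)

      r+t≤Δ : r ℕ.+ t ℕ.≤ Δ
      r+t≤Δ = ℕ.≤-trans (ℕ.+-monoˡ-≤ t (ℕ.≰⇒≥ d≰r)) (ℕ.≤-reflexive d+t≡Δ)

      d+m≤d+ : d ℕ.+ m ℕ.≤ d ℕ.+ (k ℕ.* Δ ℕ.+ (r ℕ.+ t))
      d+m≤d+ = ℕ.≤-trans d+m≤ (ℕ.≤-reflexive (≡.trans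
        (cong (λ i → i ℕ.+ k ℕ.* Δ ℕ.+ r) (≡.sym d+t≡Δ))
        (+-*-Solver.solve 4 (λ d t a r → d :+ᴺ t :+ᴺ a :+ᴺ r :=ᴺ d :+ᴺ (a :+ᴺ (r :+ᴺ t)))
          ≡.refl d t (k ℕ.* Δ) r)))
        where open +-*-Solver using () renaming (_:+_ to _:+ᴺ_; _:=_ to _:=ᴺ_)

      bound : f d * (f Δ ^ k * f (r ℕ.+ t)) ≤ f Δ ^ suc k * f r
      bound = begin
        f d * (f Δ ^ k * f (r ℕ.+ t))
          ≈⟨ solve 3 (λ a b c → a :* (b :* c) := b :* (a :* c)) refl (f d) (f Δ ^ k) (f (r ℕ.+ t)) ⟩
        f Δ ^ k * (f d * f (r ℕ.+ t))
          ≡⟨ cong (λ i → f Δ ^ k * (f i * f (r ℕ.+ t))) r+s≡d ⟨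
        f Δ ^ k * (f (r ℕ.+ s) * f (r ℕ.+ t))
          ≲⟨ *-monoʳ-≤ (1≤⇒0≤ (1≤^ k (1≤f Δ))) (f-logConvex r s t) ⟩
        f Δ ^ k * (f (r ℕ.+ (s ℕ.+ t)) * f r)
          ≡⟨ cong (λ i → f Δ ^ k * (f i * f r)) r+[s+t]≡Δ ⟩
        f Δ ^ k * (f Δ * f r)
          ≈⟨ solve 3 (λ a b c → a :* (b :* c) := (b :* a) :* c) refl (f Δ ^ k) (f Δ) (f r) ⟩
        f Δ ^ suc k * f r ∎

    -- The partition function: upper bound by deletion, and its value on matchings.

    ζ : ∀ {n} → Edges n → Carrier
    ζ {n} es = sumColourings K n (suc p) (λ σ → x ^ monochromatic es σ)

    -- For each fixed colouring of the remaining vertices, the exponents at `zero` count its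
    -- neighbours by colour and add up to their number. Hence `sum-^≤` gives a bound that does not
    -- depend on the colouring and can be pulled out.
    ζ-delete-≤ : ∀ {n} {es : Edges (suc n)} → Loopless es →
                 ζ es ≤ (fromℕ p + x ^ length (neighbours es)) * ζ (delete es)
    ζ-delete-≤ {n} {es} loopless = begin
      ζ es
        ≈⟨ sum-sumColourings-comm n (λ i σ → x ^ monochromatic es (i Vector.∷ σ)) ⟩
      sumColourings K n (suc p) (λ σ → sum (λ i → x ^ monochromatic es (i Vector.∷ σ)))
        ≲⟨ sumColourings-mono-≤ n onColouring ⟩
      sumColourings K n (suc p) (λ σ → (fromℕ p + x ^ length (neighbours es)) * x ^ monochromatic (delete es) σ)
        ≈⟨ *-distribˡ-sumColourings n _ (λ σ → x ^ monochromatic (delete es) σ) ⟨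
      (fromℕ p + x ^ length (neighbours es)) * ζ (delete es) ∎
      where
      onColouring : ∀ σ → sum (λ i → x ^ monochromatic es (i Vector.∷ σ)) ≤
                          (fromℕ p + x ^ length (neighbours es)) * x ^ monochromatic (delete es) σ
      onColouring σ = begin
        sum (λ i → x ^ monochromatic es (i Vector.∷ σ))
          ≈⟨ sum-cong-≋ (λ i → trans (^-congʳ x (monochromatic-∷ loopless i σ)) (^-homo-* x (a i) _)) ⟩
        sum (λ i → x ^ a i * x ^ monochromatic (delete es) σ)
          ≈⟨ *-distribʳ-sum (x ^ monochromatic (delete es) σ) (λ i → x ^ a i) ⟨
        sum (λ i → x ^ a i) * x ^ monochromatic (delete es) σ
          ≲⟨ *-monoˡ-≤ (1≤⇒0≤ (1≤^ (monochromatic (delete es) σ) 1≤x)) (sum-^≤ 1≤x p a) ⟩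
        (fromℕ p + x ^ ℕΣ.sum a) * x ^ monochromatic (delete es) σ
          ≡⟨ cong (λ d → (fromℕ p + x ^ d) * x ^ monochromatic (delete es) σ)
               (≡.trans (sum-multiplicity (map σ (neighbours es))) (length-map σ (neighbours es))) ⟩
        (fromℕ p + x ^ length (neighbours es)) * x ^ monochromatic (delete es) σ ∎
        where
        a : Fin (suc p) → ℕ
        a i = multiplicity i (map σ (neighbours es))

    -- The induction on vertices needs free `k` and `r`, since a deleted vertex may have fewer than
    -- `Δ` neighbours; `peel` supplies the new pair. Only an upper bound on degrees is carried
    -- along, as the maximum may drop.
    ζ-≤ : ∀ {n Δ r} k {es : Edges n} → Loopless es → (∀ v → deg es v ℕ.≤ Δ) → r ℕ.≤ Δ →
          length es ℕ.≤ k ℕ.* Δ ℕ.+ r → ζ es ≤ f Δ ^ k * f r * Q ^ n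
    -- Factors may be left over when the vertices run out; each is at least one.
    ζ-≤ {zero} {Δ} {r} k {[]} _ _ _ _ = begin
      1#                     ≲⟨ 1≤* (1≤^ k (1≤f Δ)) (1≤f r) ⟩
      f Δ ^ k * f r          ≈⟨ *-identityʳ _ ⟨
      f Δ ^ k * f r * 1#     ∎
    ζ-≤ {zero} k {(() , _) ∷ _}
    ζ-≤ {suc n} {Δ} {r} k {es} loopless deg≤Δ r≤Δ m≤ =
      let
        d = length (neighbours es)
        k′ , r′ , r′≤Δ , m′≤ , peeled =
          peel k (ℕ.≤-trans (length-neighbours≤deg es) (deg≤Δ zero)) r≤Δ
            (ℕ.≤-trans (ℕ.≤-reflexive (length-neighbours-delete loopless)) m≤)
        ih = ζ-≤ k′ (delete-loopless loopless)
               (λ v → ℕ.≤-trans (deg-delete≤deg es v) (deg≤Δ (suc v))) r′≤Δ m′≤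
      in begin
      ζ es
        ≲⟨ ζ-delete-≤ loopless ⟩
      (fromℕ p + x ^ d) * ζ (delete es)
        ≲⟨ *-monoʳ-≤ (+-nonneg (0≤fromℕ p) (1≤⇒0≤ (1≤^ d 1≤x))) ih ⟩
      (fromℕ p + x ^ d) * (f Δ ^ k′ * f r′ * Q ^ n)
        ≈⟨ *-congʳ (Q*f d) ⟨
      (Q * f d) * (f Δ ^ k′ * f r′ * Q ^ n)
        ≈⟨ solve 4 (λ Q a b c → (Q :* a) :* (b :* c) := (a :* b) :* (Q :* c)) refl
             Q (f d) (f Δ ^ k′ * f r′) (Q ^ n) ⟩
      (f d * (f Δ ^ k′ * f r′)) * Q ^ suc n
        ≲⟨ *-monoˡ-≤ (0≤Q^ (suc n)) peeled ⟩
      f Δ ^ k * f r * Q ^ suc n ∎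
      where
      0≤Q^ : ∀ i → 0# ≤ Q ^ i
      0≤Q^ i = 1≤⇒0≤ (1≤^ i (x≤x+y (0≤fromℕ p)))

    -- The first edge is disjoint from the others, so summing over the colours of its two ends gives
    -- a separate factor `Q * (Q * f Δ)`. Once the edges are used up, each remaining vertex
    -- contributes `Q`.
    matching-≈ : ∀ n Δ k (le : k ℕ.* 2 ℕ.≤ n) →
      sumColourings K n (suc p) (λ σ → x ^ matchingMonochromatic Δ k le σ) ≈ f Δ ^ k * Q ^ n
    matching-≈ n Δ zero le = trans (sumColourings-1 n (suc p)) (sym (*-identityˡ _))
    matching-≈ (suc (suc n)) Δ (suc k) (s≤s (s≤s le)) = begin-equality
      -- This form holds by computation: the first edge joins the two vertices coloured `i` and `j`,
      -- and each later edge, read on the extended colouring, reduces to an edge of the smaller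
      -- matching read on `σ`.
      sum (λ i → sum (λ j → sumColourings K n (suc p) (λ σ → x ^ (same i j ℕ.+ rest σ))))
        ≈⟨ sum-cong-≋ (λ i → sum-cong-≋ (inner i)) ⟩
      sum {suc p} (λ i → sum {suc p} (λ j → x ^ same i j * R))
        ≈⟨ sum-cong-≋ (λ i → trans (sym (*-distribʳ-sum R (λ j → x ^ same i j))) (*-congʳ (row i))) ⟩
      sum {suc p} (λ _ → Q * f Δ * R)
        ≈⟨ trans (sum-replicate (suc p)) (fromℕ-* (suc p) _) ⟩
      Q * (Q * f Δ * R)
        ≈⟨ solve 4 (λ Q f a b → Q :* (Q :* f :* (a :* b)) := f :* a :* (Q :* (Q :* b))) refl
             Q (f Δ) (f Δ ^ k) (Q ^ n) ⟩
      f Δ ^ suc k * Q ^ suc (suc n) ∎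
      where
      R : Carrier
      R = f Δ ^ k * Q ^ n

      rest : Colouring n (suc p) → ℕ
      rest = matchingMonochromatic Δ k le

      same : Fin (suc p) → Fin (suc p) → ℕ
      same i j = if does (i ≟ j) then Δ else 0

      inner : ∀ i j → sumColourings K n (suc p) (λ σ → x ^ (same i j ℕ.+ rest σ)) ≈
                      x ^ same i j * R
      inner i j = begin-equality
        sumColourings K n (suc p) (λ σ → x ^ (same i j ℕ.+ rest σ))
          ≈⟨ sumColourings-cong n (λ σ → ^-homo-* x (same i j) (rest σ)) ⟩
        sumColourings K n (suc p) (λ σ → x ^ same i j * x ^ rest σ)
          ≈⟨ *-distribˡ-sumColourings n _ (λ σ → x ^ rest σ) ⟨
        x ^ same i j * sumColourings K n (suc p) (λ σ → x ^ rest σ)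
          ≈⟨ *-congˡ (matching-≈ n Δ k le) ⟩
        x ^ same i j * R ∎

      x^same : ∀ i j → x ^ same i j ≈ (if does (i ≟ j) then x ^ Δ else 1#)
      x^same i j with does (i ≟ j)
      ... | true  = refl
      ... | false = refl

      row : ∀ i → sum (λ j → x ^ same i j) ≈ Q * f Δ
      row i = begin-equality
        sum (λ j → x ^ same i j)                          ≈⟨ sum-cong-≋ (x^same i) ⟩
        sum (λ j → if does (i ≟ j) then x ^ Δ else 1#)    ≈⟨ sum-if-≟ +-commutativeMonoid i ⟩
        x ^ Δ + fromℕ p                                   ≈⟨ +-comm _ _ ⟩
        fromℕ p + x ^ Δ                                   ≈⟨ Q*f Δ ⟨
        Q * f Δ                                           ∎

theorem3p1 : ∀ {c ℓ₁ ℓ₂} (K : OrderedField c ℓ₁ ℓ₂) → let open OrderedField K in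
    (n m Δ q : ℕ) .{{_ : NonZero Δ}} .{{_ : NonZero q}}
    (x : Carrier) → 1# ≤ x →
    ((G : Multigraph n) → numEdges G ≡ m → HasMaxDegree G Δ →
    Z K G x q ≤ (1# + q ⁻¹ * (x ^ Δ - 1#)) ^ ⌈ m / Δ ⌉ * fromℕ q ^ n)
    ×
    (.{{_ : NonZero m}} (Δ∣m : Δ ∣ m) (2m/Δ≤n : 2 ℕ.* m / Δ ℕ.≤ n) →
    Z K (H n m Δ Δ∣m 2m/Δ≤n) x q ≈ (1# + q ⁻¹ * (x ^ Δ - 1#)) ^ ⌈ m / Δ ⌉ * fromℕ q ^ n)
theorem3p1 K n m Δ q@(suc p) x 1≤x = upper , equality
  where
  open OrderedField K hiding (zero)
  open PreorderReasoning (≤-preorder K)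
  open Exp semiring using (^-congʳ)

  F : ℕ → Carrier
  F = f K p x 1≤x

  upper : (G : Multigraph n) → numEdges G ≡ m → HasMaxDegree G Δ →
          Z K G x q ≤ F Δ ^ ⌈ m / Δ ⌉ * fromℕ q ^ n
  upper G ≡.refl (deg≤Δ , _) = begin
    Z K G x q
      -- The induction starts with remainder 0, whose factor `F 0` is one.
      ≲⟨ ζ-≤ K p x 1≤x ⌈ m / Δ ⌉ (loopless G) deg≤Δ z≤n
           (ℕ.≤-trans (m≤⌈m/d⌉*d m Δ) (ℕ.m≤m+n _ 0)) ⟩
    F Δ ^ ⌈ m / Δ ⌉ * F 0 * fromℕ q ^ n
      ≈⟨ *-congʳ (trans (*-congˡ (f0≈1 K p x 1≤x)) (*-identityʳ _)) ⟩
    F Δ ^ ⌈ m / Δ ⌉ * fromℕ q ^ n ∎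

  equality : .{{_ : NonZero m}} (Δ∣m : Δ ∣ m) (2m/Δ≤n : 2 ℕ.* m / Δ ℕ.≤ n) →
             Z K (H n m Δ Δ∣m 2m/Δ≤n) x q ≈ F Δ ^ ⌈ m / Δ ⌉ * fromℕ q ^ n
  equality Δ∣m@(divides k ≡.refl) 2m/Δ≤n = begin-equality
    Z K (H n m Δ Δ∣m 2m/Δ≤n) x q
      ≈⟨ sumColourings-cong K n (λ σ → ^-congʳ x (μ-H m Δ Δ∣m 2m/Δ≤n σ)) ⟩
    sumColourings K n q (λ σ → x ^ matchingMonochromatic Δ k (2k≤n Δ∣m 2m/Δ≤n) σ)
      ≈⟨ matching-≈ K p x 1≤x n Δ k (2k≤n Δ∣m 2m/Δ≤n) ⟩
    F Δ ^ k * fromℕ q ^ n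
      -- Here `m` is `k * Δ`, so the ceiling is exactly the number of matching edges.
      ≡⟨ cong (λ i → F Δ ^ i * fromℕ q ^ n) (⌈k*d/d⌉≡k k Δ) ⟨
    F Δ ^ ⌈ m / Δ ⌉ * fromℕ q ^ n ∎
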